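{- The Modified Dhar's Burning Algorithm (defined in the context) is correct: for every graph $G$ and every input divisor $D$ on $G$, if the algorithm returns a divisor $D'$, then $D'\ge 0$ and $D'\sim D$; and if it returns NONE, then there is no divisor $D'\sim D$ with $D'\geq 0$.
   Context: All graphs are finite, connected, loopless multigraphs with nonempty vertex set $V(G)$. A divisor on $G$ is an element $D=\sum_v D(v)\cdot v$ of the free abelian group on $V(G)$; $D\ge 0$ (effective) means $D(v)\ge 0$ for all $v$. Write $D=D^+-D^-$ with $D^+(v)=\max\{D(v),0\}$, $D^-(v)=\max\{ -D(v),0\}$, and let $\mathrm{supp}(D^-)=\{v: D(v)<0\}$. For $W\subseteq V(G)$ and $v\in W$, $\mathrm{outdeg}_W(v)$ is the number of edges from $v$ to $V(G)\setminus W$. Let $\Delta:\mathbb{Z}^{V(G)}\to \mathrm{Div}(G)$ be the map given by the Laplacian matrix (diagonal entries the valences $\mathrm{val}(v)$, off-diagonal entries minus the number of edges between the two vertices), and let $\mathbb{1}_W$ be the indicator function of $W$. Divisors $D,D'$ are linearly equivalent, $D\sim D'$, if $D-D'$ lies in the image of $\Delta$. Modified Dhar's Burning Algorithm, on input a divisor $D$: (1) If $D\ge 0$, return $D$. (2) Set $W:=V(G)\setminus\mathrm{supp}(D^-)$. (3) While $W\neq\emptyset$: if there is some $v\in W$ with $D(v)<\mathrm{outdeg}_W(v)$, replace $W$ by $W\setminus\{v\}$; otherwise, call the algorithm recursively on $D-\Delta\mathbb{1}_W$ and return its result. (4) If $W=\emptyset$ is reached, return NONE. -}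

module Defs where

import Algebra.Properties.CommutativeMonoid.Sum as Sum
open import Data.Bool using (if_then_else_)
open import Data.Fin using (Fin; _≟_)
open import Data.Fin.Subset as Subset using (Subset; _∈_; Empty; Nonempty; ∁)
open import Data.Fin.Subset.Properties using (_∈?_)
open import Data.Integer using (ℤ; +_; 0ℤ; 1ℤ; _-_; _*_; -_; _≤_; _<_; _<?_)
import Data.Integer.Properties as ℤ
open import Data.Maybe using (Maybe; just; nothing)
open import Data.Nat as ℕ using (ℕ; NonZero)
import Data.Nat.Properties as ℕ
open import Data.Product using (∃-syntax)
open import Data.Vec using (tabulate)
open import Relation.Binary.Construct.Closure.ReflexiveTransitive using (Star)
open import Relation.Binary.PropositionalEquality using (_≡_)
open import Relation.Nullary using (¬_; does)

open Sum ℕ.+-0-commutativeMonoid public using () renaming (sum to ∑ℕ)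
open Sum ℤ.+-0-commutativeMonoid public using () renaming (sum to ∑ℤ)

-- A multigraph is a multiset of edges: `mult u v` is the number of edges
-- joining u and v.
record Graph : Set where
  field
    order     : ℕ
    nonempty  : NonZero order
    mult      : Fin order → Fin order → ℕ
    symmetric : ∀ u v → mult u v ≡ mult v u
    loopless  : ∀ v → mult v v ≡ 0
    connected : ∀ u v → Star (λ x y → 0 ℕ.< mult x y) u v

  V : Set
  V = Fin order

module _ (G : Graph) where
  open Graph G

  Divisor : Set
  Divisor = V → ℤ

  Effective : Divisor → Set
  Effective D = ∀ v → 0ℤ ≤ D v

  -- The support of D⁻.
  supp⁻ : Divisor → Subset order
  supp⁻ D = tabulate λ v → does (D v <? 0ℤ)

  val : V → ℕ
  val v = ∑ℕ λ w → mult v w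

  outdeg : Subset order → V → ℕ
  outdeg W v = ∑ℕ λ w → if does (w ∈? W) then 0 else mult v w

  laplacian : V → V → ℤ
  laplacian v w = if does (v ≟ w) then + val v else - + mult v w

  Δ : (V → ℤ) → Divisor
  Δ f v = ∑ℤ λ w → laplacian v w * f w

  𝟙 : Subset order → V → ℤ
  𝟙 W v = if does (v ∈? W) then 1ℤ else 0ℤ

  -- D ∼ D′; equality of divisors is pointwise.
  LinearlyEquivalent : Divisor → Divisor → Set
  LinearlyEquivalent D D′ = ∃[ f ] (∀ v → D v - D′ v ≡ Δ f v)

  -- The choice of the vertex v to remove from W is left open by the
  -- algorithm, so it is described by its big-step semantics:
  -- `Returns D r` holds when some run on input D terminates with result r,
  -- and `Loop D W r` when some run of the while loop, on the divisor D and
  -- with current set W, terminates with result r.  NONE is `nothing`.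
  mutual
    data Returns (D : Divisor) : Maybe Divisor → Set where
      effective : Effective D → Returns D (just D)
      start     : ∀ {r} → ¬ Effective D → Loop D (∁ (supp⁻ D)) r → Returns D r

    data Loop (D : Divisor) (W : Subset order) : Maybe Divisor → Set where
      none : Empty W → Loop D W nothing
      burn : ∀ {r} v → v ∈ W → D v < + outdeg W v →
             Loop D (W Subset.- v) r → Loop D W r
      fire : ∀ {r} → Nonempty W → (∀ v → v ∈ W → ¬ D v < + outdeg W v) →
             Returns (λ v → D v - Δ (𝟙 W) v) r → Loop D W r

{-# OPTIONS --safe #-}

-- Every recursive call replaces D by a linearly equivalent divisor, so only a
-- burn down to W = ∅ needs an argument.  Suppose D′ = D + Δ f is effective and
-- let A be the set where f attains its minimum.  If A ⊆ W and v ∈ A, then every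
-- edge from v contributes at most 0 to Δ f v, and at most -1 if it leaves W, so
-- D v = D′ v - Δ f v ≥ outdeg_W(v) and v cannot be burnt.  With W = V this gives
-- D v ≥ 0 on A, so A lies in the initial W; hence W never becomes empty.
module Submission where

open import Defs
import Algebra.Properties.CommutativeMonoid.Sum as Sum
import Algebra.Properties.Semiring.Sum as SemiringSum
open import Data.Bool using (if_then_else_; true)
open import Data.Fin using (Fin; zero; suc; _≟_)
open import Data.Fin.Subset using (_∈_; ⊤; ∁)
open import Data.Fin.Subset.Properties
  using (_∈?_; ∈⊤; x∈p∧x≢y⇒x∈p-y; x∉p⇒x∈∁p)
open import Data.Integer using (ℤ; +_; 0ℤ; 1ℤ; _+_; _-_; _*_; -_; _≤_; _<?_; +≤+)
import Data.Integer.Properties as ℤ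
open import Data.Integer.Tactic.RingSolver using (solve-∀)
open import Data.List using (allFin)
open import Data.List.Extrema ℤ.≤-totalOrder using (argmin; f[argmin]≤f[xs])
import Data.List.Relation.Unary.All as All
open import Data.List.Membership.Propositional.Properties using (∈-allFin)
open import Data.Maybe using (just; nothing)
open import Data.Nat as ℕ using (ℕ; NonZero)
open import Data.Product using (_×_; _,_; ∃-syntax)
open import Data.Vec.Properties using ([]=⇒lookup; lookup∘tabulate)
open import Function using (_∘_)
open import Relation.Binary.PropositionalEquality
open import Relation.Nullary using (¬_; does; yes; no)

open Sum ℤ.+-0-commutativeMonoid
  using (sum-cong-≗; sum-replicate-zero; ∑-distrib-+)
open SemiringSum ℤ.+-*-semiring using (*-distribʳ-sum)

∑ℤ-mono-≤ : ∀ {n} {f g : Fin n → ℤ} → (∀ i → f i ≤ g i) → ∑ℤ f ≤ ∑ℤ g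
∑ℤ-mono-≤ {ℕ.zero}  f≤g = ℤ.≤-refl
∑ℤ-mono-≤ {ℕ.suc n} f≤g = ℤ.+-mono-≤ (f≤g zero) (∑ℤ-mono-≤ (f≤g ∘ suc))

pos-∑ : ∀ {n} (f : Fin n → ℕ) → + ∑ℕ f ≡ ∑ℤ (λ i → + f i)
pos-∑ {ℕ.zero}  f = refl
pos-∑ {ℕ.suc n} f =
  trans (ℤ.pos-+ (f zero) _) (cong (λ s → + f zero + s) (pos-∑ (f ∘ suc)))

∑ℤ-single : ∀ {n} (i : Fin n) x → ∑ℤ (λ j → if does (i ≟ j) then x else 0ℤ) ≡ x
∑ℤ-single {ℕ.suc n} zero    x =
  trans (cong (λ s → x + s) (sum-replicate-zero n)) (ℤ.+-identityʳ x)
∑ℤ-single {ℕ.suc n} (suc i) x = trans (ℤ.+-identityˡ _) (∑ℤ-single i x)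

minimizer : ∀ {n} → NonZero n → (f : Fin n → ℤ) → ∃[ i ] (∀ j → f i ≤ f j)
minimizer {ℕ.suc n} _ f =
  -- `zero` is the starting candidate, available because the index set is nonempty; `allFin` then
  -- compares it with every index.
  argmin f zero (allFin _) ,
  λ j → All.lookup (f[argmin]≤f[xs] {f = f} zero (allFin _)) (∈-allFin j)

module _ (G : Graph) where
  open Graph G

  Δ-+ : ∀ f g v → Δ G (λ w → f w + g w) v ≡ Δ G f v + Δ G g v
  Δ-+ f g v = trans
    (sum-cong-≗ λ w → ℤ.*-distribˡ-+ (laplacian G v w) (f w) (g w))
    (∑-distrib-+ (λ w → laplacian G v w * f w) (λ w → laplacian G v w * g w))

  -- Additivity suffices: apply `Δ-+` to f - g and g, whose sum is f, and cancel.
  Δ-- : ∀ f g v → Δ G (λ w → f w - g w) v ≡ Δ G f v - Δ G g v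
  Δ-- f g v = begin
    Δ G f-g v                              ≡⟨ add-sub (Δ G f-g v) (Δ G g v) ⟩
    (Δ G f-g v + Δ G g v) - Δ G g v        ≡⟨ cong (_- Δ G g v) (Δ-+ f-g g v) ⟨
    Δ G (λ w → f-g w + g w) v - Δ G g v    ≡⟨ cong (_- Δ G g v) (sum-cong-≗ restore) ⟩
    Δ G f v - Δ G g v                      ∎
    where
    open ≡-Reasoning
    f-g : V → ℤ
    f-g w = f w - g w
    add-sub : ∀ a b → a ≡ (a + b) - b
    add-sub = solve-∀
    sub-add : ∀ a b → (a - b) + b ≡ a
    sub-add = solve-∀
    restore : ∀ w → laplacian G v w * (f-g w + g w) ≡ laplacian G v w * f w
    restore w = cong (laplacian G v w *_) (sub-add (f w) (g w))

  -- Since `val` is itself the sum of the multiplicities at v, the diagonal term spreads over the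
  -- edges. In this form the sign of each summand can be read off when f v is minimal.
  Δ-differences : ∀ f v → Δ G f v ≡ ∑ℤ (λ w → + mult v w * (f v - f w))
  Δ-differences f v = begin
    ∑ℤ (λ w → laplacian G v w * f w)
      ≡⟨ sum-cong-≗ split ⟩
    ∑ℤ (λ w → diagonal w + m w * (- f w))
      ≡⟨ ∑-distrib-+ diagonal (λ w → m w * (- f w)) ⟩
    ∑ℤ diagonal + ∑ℤ (λ w → m w * (- f w))
      ≡⟨ cong (_+ rest) (∑ℤ-single v _) ⟩
    + val G v * f v + ∑ℤ (λ w → m w * (- f w))
      ≡⟨ cong (λ d → d * f v + rest) (pos-∑ (mult v)) ⟩
    ∑ℤ m * f v + ∑ℤ (λ w → m w * (- f w))
      ≡⟨ cong (_+ rest) (*-distribʳ-sum (f v) m) ⟩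
    ∑ℤ (λ w → m w * f v) + ∑ℤ (λ w → m w * (- f w))
      ≡⟨ ∑-distrib-+ (λ w → m w * f v) (λ w → m w * (- f w)) ⟨
    ∑ℤ (λ w → m w * f v + m w * (- f w))
      ≡⟨ sum-cong-≗ (λ w → ℤ.*-distribˡ-+ (m w) (f v) (- f w)) ⟨
    ∑ℤ (λ w → m w * (f v - f w)) ∎
    where
    open ≡-Reasoning
    m diagonal : V → ℤ
    m w = + mult v w
    diagonal w = if does (v ≟ w) then + val G v * f v else 0ℤ

    rest : ℤ
    rest = ∑ℤ (λ w → m w * (- f w))

    split : ∀ w → laplacian G v w * f w ≡ diagonal w + m w * (- f w)
    split w with v ≟ w
    -- Without loops the off-diagonal summand at w = v vanishes, leaving just the valence term.
    ... | yes refl rewrite loopless v = sym (ℤ.+-identityʳ _)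
    ... | no _ = negate (m w) (f w)
      where
      negate : ∀ a b → (- a) * b ≡ 0ℤ + a * (- b)
      negate = solve-∀

  Minimizes : (V → ℤ) → V → Set
  Minimizes f v = ∀ w → f v ≤ f w

  Δ-at-minimizer : ∀ f {W} v → (∀ w → Minimizes f w → w ∈ W) →
                   Minimizes f v → Δ G f v ≤ - + outdeg G W v
  Δ-at-minimizer f {W} v min⊆W v-min = begin
    Δ G f v                                    ≡⟨ Δ-differences f v ⟩
    ∑ℤ (λ w → + mult v w * (f v - f w))        ≤⟨ ∑ℤ-mono-≤ bound ⟩
    ∑ℤ (λ w → + out w * - 1ℤ)                  ≡⟨ *-distribʳ-sum (- 1ℤ) (λ w → + out w) ⟨
    ∑ℤ (λ w → + out w) * - 1ℤ                  ≡⟨ cong (_* - 1ℤ) (pos-∑ out) ⟨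
    + outdeg G W v * - 1ℤ                      ≡⟨ ℤ.*-comm _ (- 1ℤ) ⟩
    - 1ℤ * + outdeg G W v                      ≡⟨ ℤ.-1*i≡-i _ ⟩
    - + outdeg G W v                           ∎
    where
    open ℤ.≤-Reasoning
    out : V → ℕ
    out w = if does (w ∈? W) then 0 else mult v w

    bound : ∀ w → + mult v w * (f v - f w) ≤ + out w * - 1ℤ
    bound w with w ∈? W
    ... | yes _   = ℤ.≤-trans
      (ℤ.*-monoˡ-≤-nonNeg (+ mult v w) (ℤ.i≤j⇒i-j≤0 (v-min w)))
      (ℤ.≤-reflexive (ℤ.*-zeroʳ (+ mult v w)))
    -- Here w is not a minimizer: if f v = f w, then w would minimize f too and lie in W. So f v - f
    -- w is a negative integer, hence at most -1.
    ... | no w∉W = ℤ.*-monoˡ-≤-nonNeg (+ mult v w)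
      (ℤ.i<j⇒i≤pred[j] (ℤ.≤∧≢⇒< (ℤ.i≤j⇒i-j≤0 (v-min w)) fv-fw≢0))
      where
      fv-fw≢0 : f v - f w ≢ 0ℤ
      fv-fw≢0 eq = w∉W (min⊆W w λ u →
        ℤ.≤-trans (ℤ.≤-reflexive (sym (ℤ.i-j≡0⇒i≡j (f v) (f w) eq))) (v-min u))

  -- W may be any set containing all minimizers, so the same bound serves for W = V, to place
  -- minimizers in the initial set, and for each W met while burning.
  minimizer-unburnable : ∀ D D′ {W} v → Effective G D′ →
    ((f , _) : LinearlyEquivalent G D′ D) → (∀ w → Minimizes f w → w ∈ W) →
    Minimizes f v → + outdeg G W v ≤ D v
  minimizer-unburnable D D′ {W} v D′≥0 (f , D′-D≡Δf) min⊆W v-min = begin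
    + outdeg G W v          ≡⟨ ℤ.neg-involutive _ ⟨
    - - + outdeg G W v      ≤⟨ ℤ.neg-mono-≤ (Δ-at-minimizer f v min⊆W v-min) ⟩
    - Δ G f v               ≡⟨ cong -_ (D′-D≡Δf v) ⟨
    - (D′ v - D v)          ≡⟨ ℤ.+-identityˡ _ ⟨
    0ℤ - (D′ v - D v)       ≤⟨ ℤ.+-monoˡ-≤ _ (D′≥0 v) ⟩
    D′ v - (D′ v - D v)     ≡⟨ cancel (D′ v) (D v) ⟩
    D v                     ∎
    where
    open ℤ.≤-Reasoning
    cancel : ∀ a b → a - (a - b) ≡ b
    cancel = solve-∀

  ∼-fire : ∀ D D′ g → LinearlyEquivalent G D′ D →
           LinearlyEquivalent G D′ (λ v → D v - Δ G g v)
  ∼-fire D D′ g (f , D′-D≡Δf) = (λ v → f v + g v) , λ v → begin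
    D′ v - (D v - Δ G g v)     ≡⟨ regroup (D′ v) (D v) (Δ G g v) ⟩
    (D′ v - D v) + Δ G g v     ≡⟨ cong (_+ _) (D′-D≡Δf v) ⟩
    Δ G f v + Δ G g v          ≡⟨ Δ-+ f g v ⟨
    Δ G (λ w → f w + g w) v    ∎
    where
    open ≡-Reasoning
    regroup : ∀ a b c → a - (b - c) ≡ (a - b) + c
    regroup = solve-∀

  ∼-unfire : ∀ D D′ g → LinearlyEquivalent G D′ (λ v → D v - Δ G g v) →
             LinearlyEquivalent G D′ D
  ∼-unfire D D′ g (f , eq) = (λ v → f v - g v) , λ v → begin
    D′ v - D v                            ≡⟨ regroup (D′ v) (D v) (Δ G g v) ⟩
    (D′ v - (D v - Δ G g v)) - Δ G g v    ≡⟨ cong (_- Δ G g v) (eq v) ⟩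
    Δ G f v - Δ G g v                     ≡⟨ Δ-- f g v ⟨
    Δ G (λ w → f w - g w) v               ∎
    where
    open ≡-Reasoning
    regroup : ∀ a b c → a - b ≡ (a - (b - c)) - c
    regroup = solve-∀

  ∼-refl : ∀ D → LinearlyEquivalent G D D
  ∼-refl D = (λ _ → 0ℤ) , λ v → trans (ℤ.+-inverseʳ (D v))
    (sym (trans (sum-cong-≗ (λ w → ℤ.*-zeroʳ (laplacian G v w)))
                (sum-replicate-zero order)))

  -- As `supp⁻` is a tabulated vector of Booleans, membership of v in it unfolds to the test D v < 0
  -- having answered `true`.
  nonNeg⇒∈∁supp⁻ : ∀ D v → 0ℤ ≤ D v → v ∈ ∁ (supp⁻ G D)
  nonNeg⇒∈∁supp⁻ D v 0≤Dv = x∉p⇒x∈∁p λ v∈supp →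
    negative (trans (sym (lookup∘tabulate _ v)) ([]=⇒lookup v∈supp))
    where
    negative : does (D v <? 0ℤ) ≢ true
    negative eq with D v <? 0ℤ
    ... | yes Dv<0 = ℤ.<⇒≱ Dv<0 0≤Dv
    negative () | no _

  mutual
    returns-just-sound : ∀ {D D′} → Returns G D (just D′) →
                         Effective G D′ × LinearlyEquivalent G D′ D
    returns-just-sound {D} (effective D≥0) = D≥0 , ∼-refl D
    returns-just-sound (start _ loop)      = loop-just-sound loop

    loop-just-sound : ∀ {D W D′} → Loop G D W (just D′) →
                      Effective G D′ × LinearlyEquivalent G D′ D
    loop-just-sound (burn _ _ _ loop) = loop-just-sound loop
    loop-just-sound {D} {W} {D′} (fire _ _ returns)
      with D′≥0 , D′∼ ← returns-just-sound returns =
      D′≥0 , ∼-unfire D D′ (𝟙 G W) D′∼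

  mutual
    returns-nothing-sound : ∀ {D} → Returns G D nothing → ∀ D′ →
                            LinearlyEquivalent G D′ D → ¬ Effective G D′
    returns-nothing-sound {D} (start _ loop) D′ D′∼D D′≥0 =
      loop-nothing-sound loop D′ D′∼D D′≥0 λ w w-min → nonNeg⇒∈∁supp⁻ D w
        -- For W = `⊤` the condition on minimizers is trivial, and 0 ≤ outdeg ≤ D w.
        (ℤ.≤-trans (+≤+ ℕ.z≤n)
                   (minimizer-unburnable D D′ {⊤} w D′≥0 D′∼D (λ _ _ → ∈⊤) w-min))

    -- The loop invariant is that W contains every minimizer of f. By induction on the run, a loop
    -- ending in `nothing` cannot start from a set satisfying it.
    loop-nothing-sound : ∀ {D W} → Loop G D W nothing → ∀ D′ →
      ((f , _) : LinearlyEquivalent G D′ D) → Effective G D′ →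
      ¬ (∀ w → Minimizes f w → w ∈ W)
    loop-nothing-sound (none W-empty) _ (f , _) _ min⊆W
      with v , v-min ← minimizer nonempty f = W-empty (v , min⊆W v v-min)
    loop-nothing-sound {D} (burn v _ Dv<out loop) D′ D′∼D D′≥0 min⊆W =
      loop-nothing-sound loop D′ D′∼D D′≥0 λ w w-min →
        -- The burnt vertex v is not a minimizer w, as D v is below its outdegree; so removing it
        -- preserves the invariant.
        x∈p∧x≢y⇒x∈p-y (min⊆W w w-min) λ where
          refl → ℤ.<⇒≱ Dv<out (minimizer-unburnable D D′ v D′≥0 D′∼D min⊆W w-min)
    -- Firing turns the witness f into f + `𝟙 G W`, whose minimizers may differ. The invariant is
    -- therefore not carried over but established afresh when the recursive call starts its own
    -- loop.
    loop-nothing-sound {D} {W} (fire _ _ returns) D′ D′∼D D′≥0 _ =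
      returns-nothing-sound returns D′ (∼-fire D D′ (𝟙 G W) D′∼D) D′≥0

proposition6p3 : (G : Graph) (D : Divisor G) →
    (∀ D′ → Returns G D (just D′) → Effective G D′ × LinearlyEquivalent G D′ D) ×
    (Returns G D nothing → ¬ (∃[ D′ ] (LinearlyEquivalent G D′ D × Effective G D′)))
proposition6p3 G D =
  (λ D′ → returns-just-sound G) ,
  λ { returns (D′ , D′∼D , D′≥0) → returns-nothing-sound G returns D′ D′∼D D′≥0 }
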